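{- Let $G$ be a finite abelian group of exponent $m\ge 2$, generated by a subset $S=S^{ -1}$, and let $\Gamma(G,S)$ be the corresponding Cayley graph. Then $$\mathrm{rw}(\Gamma(G,S))=\Omega\left(\frac{|G|}{m|S|^2}\right),$$ where the constant implied by $\Omega$ is a positive absolute constant.
   Context: $\Gamma(G,S)$ is the simple undirected graph with vertex set $G$ in which $x,y$ are adjacent iff $y x^{ -1}\in S$ (with $S$ not containing the identity, so that the graph is simple and $|S|$-regular). Rank-width: for a graph with vertex set $V$ and $X\subseteq V$, the cut-rank $\rho(X)$ is the $\mathbb F_2$-rank of the $0$-$1$ adjacency matrix with rows indexed by $X$ and columns by $V\setminus X$. A rank-decomposition is a pair $(T,L)$ with $T$ a tree with at least two nodes, all of degree 1 or 3, and $L$ a bijection from $V$ to the leaves of $T$; its width is the maximum over edges $e$ of $T$ of $\rho$ of the vertex set corresponding to one side of $T-e$. The rank-width $\mathrm{rw}$ is the minimum width of a rank-decomposition. -}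

module Defs where

open import Algebra.Bundles using (AbelianGroup; CommutativeRing)
import Algebra.Definitions.RawMonoid as RawMonoidDefinitions
import Algebra.Properties.AbelianGroup as AbelianGroupProperties
open import Data.Bool.Base using (Bool; true; false; _∧_)
open import Data.Bool.Properties using (xor-∧-commutativeRing)
open import Data.Empty using (⊥; ⊥-elim)
open import Data.Fin.Base using (Fin)
open import Data.Fin.Subset using (Subset; _∈_; _∉_; _⊆_; _-_; ∁; ∣_∣; Empty)
open import Data.Fin.Subset.Properties using (x∈p⇒∣p-x∣<∣p∣)
open import Data.List.Base using (List; _∷_; _∷ʳ_; length)
open import Data.List.Relation.Unary.Linked using (Linked)
open import Data.List.Relation.Unary.Unique.Propositional using (Unique)
open import Data.Nat.Base using (ℕ; _*_; _^_; _≤_; _<_; z≤n; s≤s; NonZero; ≢-nonZero)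
open import Data.Nat.Properties using (m*n≡0⇒m≡0∨n≡0; m^n≡0⇒m≡0; ≤⇒≯; n≮0)
open import Data.Product using (_×_; _,_; proj₁; proj₂; ∃-syntax)
open import Data.Sum using (_⊎_; inj₁; inj₂)
open import Data.Vec.Base using (lookup; tabulate)
open import Data.Vec.Properties using ([]=⇒lookup; lookup⇒[]=)
open import Function.Bundles using (Inverse; _⤖_; _⇔_; module Bijection; module Equivalence)
open import Level using (0ℓ) renaming (suc to lsuc)
open import Relation.Binary.Construct.Closure.ReflexiveTransitive using (Star)
open import Relation.Binary.Core using (Rel)
open import Relation.Binary.PropositionalEquality
  using (_≡_; refl; subst; setoid)
open import Relation.Nullary using (¬_)
open import Relation.Unary using (Pred)

IsMax : Pred ℕ 0ℓ → ℕ → Set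
IsMax P k = P k × (∀ j → P j → j ≤ k)

IsMin : Pred ℕ 0ℓ → ℕ → Set
IsMin P k = P k × (∀ j → P j → k ≤ j)

record Graph (n : ℕ) : Set where
  field
    adj     : Fin n → Fin n → Bool
    adj-sym : ∀ x y → adj x y ≡ true → adj y x ≡ true
    irrefl  : ∀ x → adj x x ≡ false

  Adj : Rel (Fin n) 0ℓ
  Adj x y = adj x y ≡ true

  neighbours : Fin n → Subset n
  neighbours x = tabulate (adj x)

  degree : Fin n → ℕ
  degree x = ∣ neighbours x ∣

  Connected : Set
  Connected = ∀ x y → Star Adj x y

  -- The cycle x, x₁, …, xₖ, x is given by xs = x₁, …, xₖ with k ≥ 2.
  Acyclic : Set
  Acyclic = ∀ x (xs : List (Fin n)) → 2 ≤ length xs → Unique (x ∷ xs) →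
            ¬ Linked Adj (x ∷ (xs ∷ʳ x))

  -- Adjacency after deletion of the edge uv.
  AdjWithout : Fin n → Fin n → Rel (Fin n) 0ℓ
  AdjWithout u v x y =
    Adj x y × ¬ ((x ≡ u × y ≡ v) ⊎ (x ≡ v × y ≡ u))

-- 𝔽₂ is Bool with xor as addition and ∧ as multiplication.
open RawMonoidDefinitions (CommutativeRing.+-rawMonoid xor-∧-commutativeRing)
  public using () renaming (sum to sum₂)

Matrix₂ : ℕ → ℕ → Set
Matrix₂ p q = Fin p → Fin q → Bool

-- The rows with index in Y, restricted to the columns in C, are linearly
-- independent.  A coefficient vector over 𝔽₂ is the same as a subset, namely
-- its support.
LinearlyIndependent : ∀ {p q} → Matrix₂ p q → Subset q → Subset p → Set
LinearlyIndependent {p} M C Y =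
  ∀ (a : Subset p) → a ⊆ Y →
  (∀ j → j ∈ C → sum₂ (λ i → lookup a i ∧ M i j) ≡ false) →
  Empty a

-- r is the rank of the submatrix of M with rows R and columns C.
IsRank : ∀ {p q} → Matrix₂ p q → Subset p → Subset q → ℕ → Set
IsRank M R C =
  IsMax (λ r → ∃[ Y ] Y ⊆ R × LinearlyIndependent M C Y × ∣ Y ∣ ≡ r)

IsCutRank : ∀ {n} → Graph n → Subset n → ℕ → Set
IsCutRank Γ X = IsRank (Graph.adj Γ) X (∁ X)

record RankDecomposition (n : ℕ) : Set where
  field
    nodes     : ℕ
    nodes≥2   : 2 ≤ nodes
    tree      : Graph nodes
  open Graph tree public
  field
    connected : Connected
    acyclic   : Acyclic
    cubic     : ∀ x → degree x ≡ 1 ⊎ degree x ≡ 3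

  Leaf : Set
  Leaf = ∃[ x ] degree x ≡ 1

  field
    leaves    : Fin n ⤖ Leaf

  leaf : Fin n → Fin nodes
  leaf i = proj₁ (Bijection.to leaves i)

  -- X corresponds to the component of tree − uv containing v.
  IsSide : Fin nodes → Fin nodes → Subset n → Set
  IsSide u v X = ∀ i → i ∈ X ⇔ Star (AdjWithout u v) v (leaf i)

module _ {n : ℕ} (Γ : Graph n) where

  -- Each edge occurs as (u , v) and as (v , u), so both of its sides are taken
  -- into account; they have the same cut-rank, being complementary.
  IsWidth : RankDecomposition n → ℕ → Set
  IsWidth D =
    IsMax (λ r → ∃[ u ] ∃[ v ] ∃[ X ] Adj u v × IsSide u v X × IsCutRank Γ X r)
    where open RankDecomposition D

  IsRankWidth : ℕ → Set
  IsRankWidth = IsMin (λ k → ∃[ D ] IsWidth D k)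

record FiniteAbelianGroup : Set (lsuc 0ℓ) where
  field
    abelianGroup : AbelianGroup 0ℓ 0ℓ
  open AbelianGroup abelianGroup public
    hiding (_-_) renaming (refl to ≈-refl; sym to ≈-sym; trans to ≈-trans; setoid to ≈-setoid)
  open AbelianGroupProperties abelianGroup public
  open RawMonoidDefinitions rawMonoid public using () renaming (_×_ to _·_)
  field
    order       : ℕ
    enumeration : Inverse ≈-setoid (setoid (Fin order))

  index : Carrier → Fin order
  index = Inverse.to enumeration

  element : Fin order → Carrier
  element = Inverse.from enumeration

  -- k · x is the k-th power of x.
  IsExponent : ℕ → Set
  IsExponent = IsMin (λ k → 0 < k × (∀ x → k · x ≈ ε))

  -- Subsets of the group are represented by their sets of indices.
  infix 4 _∈ᴳ_
  _∈ᴳ_ : Carrier → Subset order → Set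
  x ∈ᴳ S = index x ∈ S

  data ⟨_⟩ (S : Subset order) : Pred Carrier 0ℓ where
    gen : ∀ {x} → x ∈ᴳ S → ⟨ S ⟩ x
    one : ⟨ S ⟩ ε
    mul : ∀ {x y} → ⟨ S ⟩ x → ⟨ S ⟩ y → ⟨ S ⟩ (x ∙ y)
    inv : ∀ {x} → ⟨ S ⟩ x → ⟨ S ⟩ (x ⁻¹)
    resp : ∀ {x y} → x ≈ y → ⟨ S ⟩ x → ⟨ S ⟩ y

  Generates : Subset order → Set
  Generates S = ∀ x → ⟨ S ⟩ x

  Symmetric : Subset order → Set
  Symmetric S = ∀ x → x ∈ᴳ S ⇔ x ⁻¹ ∈ᴳ S

  ∈ᴳ-resp : ∀ S {x y} → x ≈ y → x ∈ᴳ S → y ∈ᴳ S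
  ∈ᴳ-resp S x≈y = subst (_∈ S) (Inverse.to-cong enumeration x≈y)

  private
    ratio-inverse : ∀ x y → (y ∙ x ⁻¹) ⁻¹ ≈ x ∙ y ⁻¹
    ratio-inverse x y = ≈-trans (⁻¹-anti-homo-∙ y (x ⁻¹)) (∙-congʳ (⁻¹-involutive x))

    ∉⇒lookup : ∀ {n} (S : Subset n) i → i ∉ S → lookup S i ≡ false
    ∉⇒lookup S i i∉S with lookup S i in eq
    ... | true  = ⊥-elim (i∉S (lookup⇒[]= i S eq))
    ... | false = refl

  cayleyGraph : (S : Subset order) → Symmetric S → ¬ (ε ∈ᴳ S) → Graph order
  cayleyGraph S symm ε∉S = record
    { adj     = λ i j → lookup S (index (element j ∙ element i ⁻¹))
    ; adj-sym = λ i j e → []=⇒lookup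
        (∈ᴳ-resp S (ratio-inverse (element i) (element j))
          (Equivalence.to (symm _) (lookup⇒[]= _ S e)))
    ; irrefl  = λ i → ∉⇒lookup S _ (λ e → ε∉S (∈ᴳ-resp S (inverseʳ (element i)) e))
    }

  -- Makes |G| / (m |S|²) a legitimate fraction: a group of exponent at least 2
  -- is not generated by the empty set.
  denominator-nonZero : ∀ {m} → 2 ≤ m → IsExponent m →
                        ∀ S → Generates S → NonZero (m * ∣ S ∣ ^ 2)
  denominator-nonZero {m} 2≤m (_ , least) S generates = ≢-nonZero λ eq →
    impossible (m*n≡0⇒m≡0∨n≡0 m eq)
    where
    trivial : ∣ S ∣ ≡ 0 → ∀ {x} → ⟨ S ⟩ x → x ≈ ε
    trivial S≡0 (gen x∈S)    = ⊥-elim (n≮0 (subst (∣ S - index _ ∣ <_) S≡0 (x∈p⇒∣p-x∣<∣p∣ x∈S)))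
    trivial S≡0 one          = ≈-refl
    trivial S≡0 (mul p q)    =
      ≈-trans (∙-cong (trivial S≡0 p) (trivial S≡0 q)) (identityˡ ε)
    trivial S≡0 (inv p)      = ≈-trans (⁻¹-cong (trivial S≡0 p)) ε⁻¹≈ε
    trivial S≡0 (resp x≈y p) = ≈-trans (≈-sym x≈y) (trivial S≡0 p)

    impossible : m ≡ 0 ⊎ ∣ S ∣ ^ 2 ≡ 0 → ⊥
    impossible (inj₁ refl) = n≮0 2≤m
    impossible (inj₂ eq)   = ≤⇒≯ (least 1 (s≤s z≤n , λ x →
      ≈-trans (identityʳ x) (trivial (m^n≡0⇒m≡0 ∣ S ∣ 2 eq) (generates x)))) 2≤m

{-# OPTIONS --safe #-}

-- A rank decomposition has an edge whose two sides X and Xᶜ both contain at least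
-- a third of the n = |G| vertices: walk away from a leaf, always entering a branch
-- with at least n/3 leaves; while more than 2n/3 leaves lie ahead, one of the at
-- most two branches ahead qualifies, and it has fewer nodes.  On average,
-- translation by a group element moves |X||Xᶜ|/n elements of X out of X.  The
-- number d(g) of elements which translation by g moves out of X is subadditive in
-- g, and every g is a product of powers sᵏ with s ∈ S distinct and 0 ≤ k < m, so
-- that d(g) ≤ m e, where e = Σ d(s) over s ∈ S is the number of edges between X
-- and Xᶜ.  Finally e ≤ ρ(X) |S|²: a nonzero column of the cut matrix is nonzero in
-- one of ρ(X) basis rows, and rows and columns contain at most |S| ones.
-- Together, n² / 9 ≤ |X||Xᶜ| ≤ n m |S|² ρ(X).
module Submission where

open import Defs
open import Algebra.Bundles using (CommutativeMonoid; module CommutativeRing)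
import Algebra.Properties.CommutativeMonoid.Sum as MonoidSum
import Algebra.Properties.Monoid.Mult as Mult
import Algebra.Properties.Semiring.Sum as SemiringSum
open import Data.Bool.Base using (Bool; true; false; _∧_; not)
import Data.Bool.Properties as Bool
open import Data.Bool.Properties using (∧-identityʳ; xor-∧-commutativeRing; ¬-not)
open import Data.Empty using (⊥)
open import Data.Fin.Base using (Fin; zero; suc; punchIn; fromℕ<)
open import Data.Fin.Permutation using (Permutation′; permutation)
open import Data.Fin.Properties using (_≟_; punchInᵢ≢i; any?; sequence)
open import Data.Fin.Subset using (Subset; ∣_∣; _∈_; _∉_; _⊆_; _∪_; _-_; ⁅_⁆; ∁; ⊤) renaming (⊥ to ∅)
open import Data.Fin.Subset.Properties
  using (_∈?_; p⊆p∪q; x∈p∪q⁺; x∈p∪q⁻; x∈⁅x⁆; x∈⁅y⁆⇒x≡y; p⊂q⇒∣p∣<∣q∣; x∈p⇒∣p-x∣<∣p∣;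
         x∈p∧x≢y⇒x∈p-y; p─q⊆p; ∣∁p∣≡n∸∣p∣; ∣p∣≤n; ∣⊤∣≡n; ⊥⊆; ∉⊥)
open import Data.Integer.Base using (+_)
import Data.Integer.Base as ℤ
import Data.Integer.Properties as ℤ
open import Data.List.Base using ([]; _∷_; _∷ʳ_)
open import Data.List.Membership.Propositional using () renaming (_∈_ to _∈ᴸ_)
import Data.List.Membership.DecPropositional as DecMembership
open import Data.List.Relation.Unary.All using ([]; _∷_)
open import Data.List.Relation.Unary.All.Properties using (¬Any⇒All¬)
open import Data.List.Relation.Unary.AllPairs using ([]; _∷_)
open import Data.List.Relation.Unary.Any using (here; there)
import Data.List.Relation.Unary.Linked as Linked
open Linked using (Linked; [-]; _∷_)
open import Data.List.Relation.Unary.Unique.Propositional using (Unique)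
open import Data.Nat.Base using (ℕ; zero; suc; pred; _+_; _^_; _≤_; _<_; z≤n; s≤s; NonZero; >-nonZero)
  renaming (_*_ to _*ℕ_)
import Data.Nat.DivMod as ℕ
open import Data.Nat.DivMod using (m≡m%n+[m/n]*n; m%n<n)
open import Data.Nat.Induction using (Acc; acc; <-wellFounded)
open import Data.Nat.Properties hiding (_≟_)
open import Data.Nat.Tactic.RingSolver using (solve-∀)
open import Data.Product using (_×_; _,_; proj₁; proj₂; ∃-syntax)
open import Data.Rational.Base using (ℚ; 0ℚ; _/_; _*_; toℚᵘ) renaming (_≤_ to _≤ℚ_; _<_ to _<ℚ_)
import Data.Rational.Properties as ℚ
import Data.Rational.Unnormalised.Base as ℚᵘ
import Data.Rational.Unnormalised.Properties as ℚᵘ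
open import Data.Sum using (_⊎_; inj₁; inj₂)
open import Data.Vec.Base using ([]; _∷_; here; there; lookup; tabulate)
open import Data.Vec.Properties using ([]=⇒lookup; lookup⇒[]=; lookup∘tabulate; lookup-map)
open import Effect.Monad using (RawMonad)
open import Function.Base using (_∘_)
open import Function.Bundles using (Inverse; module Bijection; mk⇔)
open import Level using (0ℓ)
import Relation.Binary.Construct.Closure.ReflexiveTransitive as Star
open Star using (Star; _◅_; _◅◅_)
open import Relation.Binary.Core using (Rel)
open import Relation.Binary.PropositionalEquality
  using (_≡_; _≢_; refl; sym; trans; cong; cong₂; subst; subst₂; module ≡-Reasoning)
import Relation.Binary.Reasoning.Setoid as SetoidReasoning
open import Relation.Nullary using (¬_; yes; no; contradiction; does)
open import Relation.Nullary.Decidable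
  using (Dec; _×-dec_; ¬¬-excluded-middle; dec-true; dec-false; decidable-stable)
open import Relation.Nullary.Negation using (¬¬-Monad)
open import Relation.Unary using (Pred; Decidable)

-- Finite sums, indicators and maxima.

open SemiringSum +-*-semiring
  using (sum; sum-syntax; sum-cong-≗; ∑-comm; ∑-distrib-+; sum-permute; *-distribˡ-sum; *-distribʳ-sum)

module _ {c ℓ} (M : CommutativeMonoid c ℓ) where
  open CommutativeMonoid M
  open MonoidSum M using ()
    renaming (sum to ∑; sum-remove to ∑-remove; sum-cong-≋ to ∑-cong; sum-replicate-zero to ∑-zero)

  -- General in the monoid because it serves three of them: 𝔽₂ under xor, the group itself, and ℕ
  -- under addition.
  sum-single : ∀ {n} (f : Fin n → Carrier) i → (∀ j → j ≢ i → f j ≈ ε) → ∑ f ≈ f i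
  sum-single {suc n} f i others = begin
    ∑ f                               ≈⟨ ∑-remove {i = i} f ⟩
    f i ∙ ∑ (λ j → f (punchIn i j))   ≈⟨ ∙-congˡ (∑-cong (λ j → others _ (punchInᵢ≢i i j))) ⟩
    f i ∙ ∑ {n} (λ _ → ε)             ≈⟨ ∙-congˡ (∑-zero n) ⟩
    f i ∙ ε                           ≈⟨ identityʳ (f i) ⟩
    f i                               ∎
    where open SetoidReasoning setoid

-- Cardinalities and edge counts are written as sums of products of these indicators, so that double
-- counting becomes an exchange of sums.
𝟙 : Bool → ℕ
𝟙 false = 0
𝟙 true  = 1

𝟙≤1 : ∀ b → 𝟙 b ≤ 1
𝟙≤1 false = z≤n
𝟙≤1 true  = ≤-refl

sum-mono-≤ : ∀ {n} {f g : Fin n → ℕ} → (∀ i → f i ≤ g i) → sum f ≤ sum g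
sum-mono-≤ {zero}  f≤g = z≤n
sum-mono-≤ {suc n} f≤g = +-mono-≤ (f≤g zero) (sum-mono-≤ (f≤g ∘ suc))

term≤sum : ∀ {n} (f : Fin n → ℕ) i → f i ≤ sum f
term≤sum f zero    = m≤m+n _ _
term≤sum f (suc i) = ≤-trans (term≤sum (f ∘ suc) i) (m≤n+m _ (f zero))

sum-const : ∀ n k → ∑[ i < n ] k ≡ n *ℕ k
sum-const zero    k = refl
sum-const (suc n) k = cong (λ z → k + z) (sum-const n k)

∣p∣≡sum : ∀ {n} (p : Subset n) → ∣ p ∣ ≡ ∑[ i < n ] 𝟙 (lookup p i)
∣p∣≡sum []            = refl
∣p∣≡sum (true ∷ p)    = cong suc (∣p∣≡sum p)
∣p∣≡sum (false ∷ p)   = ∣p∣≡sum p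

sum-over-subset-≤ : ∀ {n} (p : Subset n) (f : Fin n → ℕ) k → (∀ i → i ∈ p → f i ≤ k) →
                    ∑[ i < n ] (𝟙 (lookup p i) *ℕ f i) ≤ ∣ p ∣ *ℕ k
sum-over-subset-≤ []          f k f≤k = z≤n
sum-over-subset-≤ (true ∷ p)  f k f≤k =
  +-mono-≤ (≤-trans (≤-reflexive (*-identityˡ _)) (f≤k zero here))
           (sum-over-subset-≤ p (f ∘ suc) k (λ i i∈p → f≤k (suc i) (there i∈p)))
sum-over-subset-≤ (false ∷ p) f k f≤k =
  sum-over-subset-≤ p (f ∘ suc) k (λ i i∈p → f≤k (suc i) (there i∈p))

-- `P` need not be decidable, hence the double negation: an element that is not maximal can be
-- replaced by a larger one, and the bound `b` stops this.
max-exists : ∀ (P : Pred ℕ 0ℓ) b → (∀ k → P k → k ≤ b) → ∀ {k} → P k → ¬ ¬ (∃[ r ] IsMax P r)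
max-exists P b P≤b {k} Pk noMax = climb b k Pk (m≤m+n b k)
  where
  -- s bounds how far beyond k the elements of P can reach
  climb : ∀ s k → P k → b ≤ s + k → ⊥
  climb zero    k Pk b≤k   = noMax (k , Pk , λ j Pj → ≤-trans (P≤b j Pj) b≤k)
  climb (suc s) k Pk b≤s+k = ¬¬-excluded-middle {A = ∃[ j ] P j × k < j} λ where
    (yes (j , Pj , k<j)) → climb s j Pj
      (≤-trans b≤s+k (≤-trans (≤-reflexive (sym (+-suc s k))) (+-monoʳ-≤ s k<j)))
    (no none) → noMax (k , Pk , λ j Pj → ≮⇒≥ (λ k<j → none (j , Pj , k<j)))

-- Rank over 𝔽₂ and the number of ones in a matrix.

module _ {p q} (M : Matrix₂ p q) {R : Subset p} {C : Subset q} where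

  -- If `M i j` were `true`, row `i` could be added to `Y`: since column `j` vanishes on `Y`, a
  -- linear relation read in that column leaves only the term of `i`, so the coefficient of `i` is
  -- zero and the relation lives on `Y`. This contradicts the maximality of `Y`.
  vanishing-on-basis : ∀ {Y} → Y ⊆ R → LinearlyIndependent M C Y →
    (∀ Z → Z ⊆ R → LinearlyIndependent M C Z → ∣ Z ∣ ≤ ∣ Y ∣) →
    ∀ {j} → j ∈ C → (∀ i → i ∈ Y → M i j ≡ false) → ∀ i → i ∈ R → M i j ≡ false
  vanishing-on-basis {Y} Y⊆R indep maximal {j} j∈C vanish i i∈R = ¬-not λ Mij →
    let i∉Y : i ∉ Y
        i∉Y i∈Y = contradiction (trans (sym Mij) (vanish i i∈Y)) λ ()
    in <⇒≱ (p⊂q⇒∣p∣<∣q∣ (p⊆p∪q ⁅ i ⁆ , i , x∈p∪q⁺ (inj₂ (x∈⁅x⁆ i)) , i∉Y))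
           (maximal (Y ∪ ⁅ i ⁆) Y∪i⊆R (Y∪i-indep Mij))
    where
    Y∪i⊆R : Y ∪ ⁅ i ⁆ ⊆ R
    Y∪i⊆R x∈ with x∈p∪q⁻ Y ⁅ i ⁆ x∈
    ... | inj₁ x∈Y = Y⊆R x∈Y
    ... | inj₂ x∈i rewrite x∈⁅y⁆⇒x≡y i x∈i = i∈R

    Y∪i-indep : M i j ≡ true → LinearlyIndependent M C (Y ∪ ⁅ i ⁆)
    Y∪i-indep Mij a a⊆ zeros = indep a a⊆Y zeros
      where
      offI : ∀ k → k ≢ i → lookup a k ∧ M k j ≡ false
      offI k k≢i with lookup a k in ak
      ... | false = refl
      ... | true with x∈p∪q⁻ Y ⁅ i ⁆ (a⊆ (lookup⇒[]= k a ak))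
      ... | inj₁ k∈Y = vanish k k∈Y
      ... | inj₂ k∈i = contradiction (x∈⁅y⁆⇒x≡y i k∈i) k≢i

      ai : lookup a i ≡ false
      ai = begin
        lookup a i                       ≡⟨ ∧-identityʳ _ ⟨
        lookup a i ∧ true                ≡⟨ cong (lookup a i ∧_) Mij ⟨
        lookup a i ∧ M i j
          ≡⟨ sum-single (CommutativeRing.+-commutativeMonoid xor-∧-commutativeRing) (λ k → lookup a k ∧ M k j) i offI ⟨
        sum₂ (λ k → lookup a k ∧ M k j)  ≡⟨ zeros j j∈C ⟩
        false                            ∎
        where open ≡-Reasoning

      a⊆Y : a ⊆ Y
      a⊆Y {k} k∈a with x∈p∪q⁻ Y ⁅ i ⁆ (a⊆ k∈a)
      ... | inj₁ k∈Y = k∈Y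
      ... | inj₂ k∈i = contradiction
        (trans (sym ([]=⇒lookup (subst (_∈ a) (x∈⁅y⁆⇒x≡y i k∈i) k∈a))) ai) λ ()

  -- Take a largest independent set `Y` of rows and charge each column to its ones in `Y`. One such
  -- entry pays `Δ` for the entire column, and a column without any vanishes on `R` by
  -- `vanishing-on-basis`. The rows in `Y` contain at most `r *ℕ Δ` ones.
  ones≤rank*Δ² : ∀ {r} Δ → (∀ i → ∑[ j < q ] 𝟙 (M i j) ≤ Δ) → (∀ j → ∑[ i < p ] 𝟙 (M i j) ≤ Δ) →
    IsRank M R C r →
    ∑[ i < p ] ∑[ j < q ] (𝟙 (lookup R i) *ℕ (𝟙 (lookup C j) *ℕ 𝟙 (M i j))) ≤ r *ℕ (Δ *ℕ Δ)
  ones≤rank*Δ² {r} Δ rows cols ((Y , Y⊆R , indep , refl) , max) = begin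
    ∑[ i < p ] ∑[ j < q ] (𝟙 (lookup R i) *ℕ (𝟙 (lookup C j) *ℕ 𝟙 (M i j)))
      ≡⟨ ∑-comm (λ i j → 𝟙 (lookup R i) *ℕ (𝟙 (lookup C j) *ℕ 𝟙 (M i j))) ⟩
    ∑[ j < q ] ∑[ i < p ] (𝟙 (lookup R i) *ℕ (𝟙 (lookup C j) *ℕ 𝟙 (M i j)))
      ≤⟨ sum-mono-≤ column ⟩
    ∑[ j < q ] (Δ *ℕ ∑[ i < p ] (𝟙 (lookup Y i) *ℕ 𝟙 (M i j)))
      ≡⟨ *-distribˡ-sum Δ (λ j → ∑[ i < p ] (𝟙 (lookup Y i) *ℕ 𝟙 (M i j))) ⟨
    Δ *ℕ ∑[ j < q ] ∑[ i < p ] (𝟙 (lookup Y i) *ℕ 𝟙 (M i j))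
      ≡⟨ cong (Δ *ℕ_) (∑-comm (λ i j → 𝟙 (lookup Y i) *ℕ 𝟙 (M i j))) ⟨
    Δ *ℕ ∑[ i < p ] ∑[ j < q ] (𝟙 (lookup Y i) *ℕ 𝟙 (M i j))
      ≡⟨ cong (Δ *ℕ_) (sum-cong-≗ (λ i → *-distribˡ-sum (𝟙 (lookup Y i)) (λ j → 𝟙 (M i j)))) ⟨
    Δ *ℕ ∑[ i < p ] (𝟙 (lookup Y i) *ℕ ∑[ j < q ] 𝟙 (M i j))
      ≤⟨ *-monoʳ-≤ Δ (sum-over-subset-≤ Y _ Δ (λ i _ → rows i)) ⟩
    Δ *ℕ (∣ Y ∣ *ℕ Δ)
      ≡⟨ *-comm Δ (∣ Y ∣ *ℕ Δ) ⟩
    ∣ Y ∣ *ℕ Δ *ℕ Δ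
      ≡⟨ *-assoc ∣ Y ∣ Δ Δ ⟩
    ∣ Y ∣ *ℕ (Δ *ℕ Δ) ∎
    where
    open ≤-Reasoning

    maximal : ∀ Z → Z ⊆ R → LinearlyIndependent M C Z → ∣ Z ∣ ≤ ∣ Y ∣
    maximal Z Z⊆R Zindep = max ∣ Z ∣ (Z , Z⊆R , Zindep , refl)

    drop : ∀ b x → 𝟙 b *ℕ x ≤ x
    drop b x = ≤-trans (*-monoˡ-≤ x (𝟙≤1 b)) (≤-reflexive (*-identityˡ x))

    column : ∀ j → ∑[ i < p ] (𝟙 (lookup R i) *ℕ (𝟙 (lookup C j) *ℕ 𝟙 (M i j)))
                   ≤ Δ *ℕ ∑[ i < p ] (𝟙 (lookup Y i) *ℕ 𝟙 (M i j))
    column j with any? (λ i → (i ∈? Y) ×-dec (M i j Bool.≟ true))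
    ... | yes (i , i∈Y , Mij) = begin
      _                       ≤⟨ sum-mono-≤ (λ i → ≤-trans (drop (lookup R i) _) (drop (lookup C j) _)) ⟩
      ∑[ i < p ] 𝟙 (M i j)    ≤⟨ cols j ⟩
      Δ                       ≡⟨ *-identityʳ Δ ⟨
      Δ *ℕ 1                  ≡⟨ cong (Δ *ℕ_) (cong₂ (λ x y → 𝟙 x *ℕ 𝟙 y) ([]=⇒lookup i∈Y) Mij) ⟨
      Δ *ℕ (𝟙 (lookup Y i) *ℕ 𝟙 (M i j)) ≤⟨ *-monoʳ-≤ Δ (term≤sum (λ i → 𝟙 (lookup Y i) *ℕ 𝟙 (M i j)) i) ⟩
      _                       ∎
    ... | no none = begin
      _                       ≤⟨ sum-mono-≤ vanishes ⟩
      ∑[ i < p ] 0            ≡⟨ trans (sum-const p 0) (*-zeroʳ p) ⟩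
      0                       ≤⟨ z≤n ⟩
      _                       ∎
      where
      vanishes : ∀ i → 𝟙 (lookup R i) *ℕ (𝟙 (lookup C j) *ℕ 𝟙 (M i j)) ≤ 0
      vanishes i with lookup R i in Ri | lookup C j in Cj
      ... | false | _     = z≤n
      ... | true  | false = z≤n
      ... | true  | true
        rewrite vanishing-on-basis Y⊆R indep maximal (lookup⇒[]= j C Cj)
                  (λ k k∈Y → ¬-not (λ Mkj → none (k , k∈Y , Mkj))) i (lookup⇒[]= i R Ri) = z≤n

-- Walks, simple paths and branches of trees.

module _ {N : ℕ} where

  -- (x ∷ xs) ∷ʳ u is a simple path from x to u.
  SimplePath : Rel (Fin N) 0ℓ → Fin N → Fin N → Set
  SimplePath R x u = ∃[ xs ] Unique (u ∷ x ∷ xs) × Linked R (x ∷ (xs ∷ʳ u))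

  private variable
    R : Rel (Fin N) 0ℓ

  suffix : ∀ {x u y ys} → x ∈ᴸ y ∷ ys → Unique (u ∷ y ∷ ys) → Linked R (y ∷ (ys ∷ʳ u)) → SimplePath R x u
  suffix (here refl) unique linked = _ , unique , linked
  suffix {ys = _ ∷ _} (there x∈ys) ((_ ∷ u∉ys) ∷ (_ ∷ unique)) (_ ∷ linked) =
    suffix x∈ys (u∉ys ∷ unique) linked

  -- Induction on the walk: if the new first vertex already lies on the path obtained from the rest,
  -- the path is cut down to its suffix starting there.
  loop-erasure : ∀ {x u} → Star R x u → x ≡ u ⊎ SimplePath R x u
  loop-erasure Star.ε = inj₁ refl
  loop-erasure {x = x} {u} (_◅_ {j = y} Rxy walk) with x ≟ u
  ... | yes x≡u = inj₁ x≡u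
  ... | no  x≢u with loop-erasure walk
  ... | inj₁ refl = inj₂ ([] , ((x≢u ∘ sym) ∷ []) ∷ [] ∷ [] , Rxy ∷ [-])
  ... | inj₂ (ys , unique@(u∉ ∷ unique′) , linked) with DecMembership._∈?_ _≟_ x (y ∷ ys)
  ... | yes x∈ = inj₂ (suffix x∈ unique linked)
  ... | no  x∉ = inj₂ (y ∷ ys , ((x≢u ∘ sym) ∷ u∉) ∷ ¬Any⇒All¬ _ x∉ ∷ unique′ , Rxy ∷ linked)

module _ {N : ℕ} (T : Graph N) where
  open Graph T

  Adj-sym : ∀ {x y} → Adj x y → Adj y x
  Adj-sym = adj-sym _ _

  Adj⇒≢ : ∀ {x y} → Adj x y → x ≢ y
  Adj⇒≢ {x} xy refl = contradiction (trans (sym xy) (irrefl x)) λ ()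

  -- After its last visit to `u` the walk steps to some `c` and then avoids `u`, so it cannot use
  -- the edge `uc` again. The relation `R` is kept for the exit step, so that an edge already
  -- deleted, namely the one towards the parent, is ruled out as exit.
  last-exit : ∀ {R : Rel (Fin N) 0ℓ} → (∀ {x y} → R x y → Adj x y) → ∀ {u ℓ} → Star R u ℓ →
              ℓ ≡ u ⊎ ∃[ c ] R u c × Star (AdjWithout u c) c ℓ
  last-exit {R} R⊆Adj {u} {ℓ} walk with go walk
    where
    Avoiding : Rel (Fin N) 0ℓ
    Avoiding x y = Adj x y × x ≢ u × y ≢ u

    toWithout : ∀ {c x} → Star Avoiding x ℓ → Star (AdjWithout u c) x ℓ
    toWithout Star.ε = Star.ε
    toWithout ((xy , x≢u , y≢u) ◅ w) =
      (xy , λ { (inj₁ (x≡u , _)) → x≢u x≡u ; (inj₂ (_ , y≡u)) → y≢u y≡u }) ◅ toWithout w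

    from-u : Star Avoiding u ℓ → ℓ ≡ u
    from-u Star.ε = refl
    from-u ((_ , u≢u , _) ◅ _) = contradiction refl u≢u

    go : ∀ {x} → Star R x ℓ → (ℓ ≡ u ⊎ ∃[ c ] R u c × Star (AdjWithout u c) c ℓ) ⊎ Star Avoiding x ℓ
    go Star.ε = inj₂ Star.ε
    go {x} (_◅_ {j = y} Rxy w) with go w
    ... | inj₁ found = inj₁ found
    ... | inj₂ avoiding with x ≟ u | y ≟ u
    ... | yes refl | _        = inj₁ (inj₂ (y , Rxy , toWithout avoiding))
    ... | no _     | yes refl = inj₁ (inj₁ (from-u avoiding))
    ... | no x≢u   | no y≢u   = inj₂ ((R⊆Adj Rxy , x≢u , y≢u) ◅ avoiding)
  ... | inj₁ found = found
  ... | inj₂ Star.ε     = inj₁ refl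
  ... | inj₂ ((_ , u≢u , _) ◅ _) = contradiction refl u≢u

  module _ (acyclic : Acyclic) where

    -- Loop erasure makes the walk a simple path from `v` to `u`. A path of one step would be the
    -- deleted edge; a longer one is closed to a cycle by `uv`.
    bridge : ∀ {u v} → Adj u v → ¬ Star (AdjWithout u v) v u
    bridge {u} {v} uv walk with loop-erasure walk
    ... | inj₁ v≡u = Adj⇒≢ uv (sym v≡u)
    ... | inj₂ ([] , _ , (_ , kept) ∷ _) = kept (inj₂ (refl , refl))
    ... | inj₂ (y ∷ ys , unique , linked) =
      acyclic u (v ∷ y ∷ ys) (s≤s (s≤s z≤n)) unique (uv ∷ Linked.map proj₁ linked)

    -- By `bridge`, a walk from `c` without the edge `uc` never meets `u`, hence never uses `pu`.
    -- The inner recursion carries the part of the walk already traversed, to which `bridge` is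
    -- applied.
    branch⊆side : ∀ {p u c x} → Adj u c → c ≢ p →
                  Star (AdjWithout u c) c x → Star (AdjWithout p u) u x
    branch⊆side {p} {u} {c} uc c≢p walk = first ◅ go Star.ε walk
      where
      first : AdjWithout p u u c
      first = uc , λ { (inj₁ (_ , c≡u)) → Adj⇒≢ uc (sym c≡u) ; (inj₂ (_ , c≡p)) → c≢p c≡p }

      go : ∀ {y x} → Star (AdjWithout u c) c y → Star (AdjWithout u c) y x → Star (AdjWithout p u) y x
      go before Star.ε = Star.ε
      go before (step@(yz , _) ◅ after) =
        (yz , λ { (inj₁ (_ , z≡u)) → avoids (before ◅◅ (step ◅ Star.ε)) z≡u
                ; (inj₂ (y≡u , _)) → avoids before y≡u })
        ◅ go (before ◅◅ (step ◅ Star.ε)) after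
        where
        avoids : ∀ {z} → Star (AdjWithout u c) c z → z ≢ u
        avoids walk refl = bridge uc walk

-- Displacement of sets by translations in a finite abelian group.

module Isoperimetry (G : FiniteAbelianGroup) where
  open FiniteAbelianGroup G
  private module ΣG = MonoidSum commutativeMonoid
  open Mult monoid using (×-congʳ; ×-homo-+; ×-assocˡ)

  element-index : ∀ x → element (index x) ≈ x
  element-index x = Inverse.strictlyInverseʳ enumeration x

  index-element : ∀ i → index (element i) ≡ i
  index-element i = Inverse.strictlyInverseˡ enumeration i

  index-cong : ∀ {x y} → x ≈ y → index x ≡ index y
  index-cong = Inverse.to-cong enumeration

  translate : Carrier → Fin order → Fin order
  translate x i = index (element i ∙ x)

  translate-∙ : ∀ x y i → translate y (translate x i) ≡ translate (x ∙ y) i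
  translate-∙ x y i = index-cong (≈-trans (∙-congʳ (element-index _)) (assoc _ x y))

  translate-≈ε : ∀ {x} → x ≈ ε → ∀ i → translate x i ≡ i
  translate-≈ε x≈ε i = trans (index-cong (≈-trans (∙-congˡ x≈ε) (identityʳ _))) (index-element i)

  translation : Carrier → Permutation′ order
  translation x = permutation (translate x) (translate (x ⁻¹))
    (λ i → trans (translate-∙ (x ⁻¹) x i) (translate-≈ε (inverseˡ x) i))
    (λ i → trans (translate-∙ x (x ⁻¹) i) (translate-≈ε (inverseʳ x) i))

  sum-translate : ∀ (f : Fin order → ℕ) x → sum f ≡ ∑[ i < order ] f (translate x i)
  sum-translate f x = sum-permute f (translation x)

  -- Adjacency of `i` and `j` tests membership of the ratio of their elements in `S`; that this
  -- ratio carries `i` to `j` links edges with displacements.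
  translate-ratio : ∀ i j → translate (element (translate (element i ⁻¹) j)) i ≡ j
  translate-ratio i j = trans (index-cong (begin
    element i ∙ element (translate (element i ⁻¹) j)  ≈⟨ ∙-congˡ (element-index _) ⟩
    element i ∙ (element j ∙ element i ⁻¹)            ≈⟨ comm _ _ ⟩
    (element j ∙ element i ⁻¹) ∙ element i            ≈⟨ assoc _ _ _ ⟩
    element j ∙ (element i ⁻¹ ∙ element i)            ≈⟨ ∙-congˡ (inverseˡ _) ⟩
    element j ∙ ε                                     ≈⟨ identityʳ _ ⟩
    element j                                         ∎)) (index-element j)
    where open SetoidReasoning ≈-setoid

  module _ (X : Subset order) where

    displacement : Carrier → ℕ
    displacement x = ∑[ i < order ] (𝟙 (lookup X i) *ℕ 𝟙 (lookup (∁ X) (translate x i)))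

    displacement-cong : ∀ {x y} → x ≈ y → displacement x ≡ displacement y
    displacement-cong x≈y = sum-cong-≗ λ i →
      cong (λ j → 𝟙 (lookup X i) *ℕ 𝟙 (lookup (∁ X) j)) (index-cong (∙-congˡ x≈y))

    displacement-ε : displacement ε ≡ 0
    displacement-ε = trans (sum-cong-≗ stays) (trans (sum-const order 0) (*-zeroʳ order))
      where
      stays : ∀ i → 𝟙 (lookup X i) *ℕ 𝟙 (lookup (∁ X) (translate ε i)) ≡ 0
      stays i rewrite translate-≈ε ≈-refl i | lookup-map i not X with lookup X i
      ... | true  = refl
      ... | false = refl

    -- A point of `X` that ends outside `X` either leaves at the step by `x`, or is still in `X`
    -- after it and leaves at the step by `y`. The points of the second kind are counted after
    -- reindexing by the translation by `x`.
    displacement-∙ : ∀ x y → displacement (x ∙ y) ≤ displacement x + displacement y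
    displacement-∙ x y = begin
      displacement (x ∙ y)
        ≤⟨ sum-mono-≤ split ⟩
      ∑[ i < order ] (𝟙 (lookup X i) *ℕ 𝟙 (lookup (∁ X) (translate x i))
                     + 𝟙 (lookup X (translate x i)) *ℕ 𝟙 (lookup (∁ X) (translate y (translate x i))))
        ≡⟨ ∑-distrib-+ (λ i → 𝟙 (lookup X i) *ℕ 𝟙 (lookup (∁ X) (translate x i))) _ ⟩
      displacement x + ∑[ i < order ] (𝟙 (lookup X (translate x i)) *ℕ 𝟙 (lookup (∁ X) (translate y (translate x i))))
        ≡⟨ cong (λ z → displacement x + z) (sum-translate (λ i → 𝟙 (lookup X i) *ℕ 𝟙 (lookup (∁ X) (translate y i))) x) ⟨
      displacement x + displacement y ∎
      where
      open ≤-Reasoning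
      split : ∀ i → 𝟙 (lookup X i) *ℕ 𝟙 (lookup (∁ X) (translate (x ∙ y) i))
                  ≤ 𝟙 (lookup X i) *ℕ 𝟙 (lookup (∁ X) (translate x i))
                    + 𝟙 (lookup X (translate x i)) *ℕ 𝟙 (lookup (∁ X) (translate y (translate x i)))
      split i rewrite translate-∙ x y i | lookup-map (translate x i) not X
        with lookup X i | lookup X (translate x i) | lookup (∁ X) (translate (x ∙ y) i)
      ... | false | _     | _     = z≤n
      ... | true  | _     | false = z≤n
      ... | true  | true  | true  = ≤-refl
      ... | true  | false | true  = ≤-refl

    displacement-· : ∀ k x → displacement (k · x) ≤ k *ℕ displacement x
    displacement-· zero    x = ≤-reflexive displacement-ε
    displacement-· (suc k) x =
      ≤-trans (displacement-∙ x (k · x)) (+-monoʳ-≤ (displacement x) (displacement-· k x))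

    displacement-sum : ∀ {k} (f : Fin k → Carrier) →
                       displacement (ΣG.sum f) ≤ ∑[ i < k ] displacement (f i)
    displacement-sum {zero}  f = ≤-reflexive displacement-ε
    displacement-sum {suc k} f = ≤-trans (displacement-∙ (f zero) (ΣG.sum (f ∘ suc)))
      (+-monoʳ-≤ (displacement (f zero)) (displacement-sum (f ∘ suc)))

    -- For fixed `i` in `X`, the translates of `i` by all group elements run through the group once,
    -- so exactly `∣ ∁ X ∣` of them lie outside `X`. Commutativity presents them as the image of the
    -- permutation `translation (element i)`.
    sum-displacement : ∑[ g < order ] displacement (element g) ≡ ∣ X ∣ *ℕ ∣ ∁ X ∣
    sum-displacement = begin
      ∑[ g < order ] ∑[ i < order ] (𝟙 (lookup X i) *ℕ 𝟙 (lookup (∁ X) (translate (element g) i)))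
        ≡⟨ ∑-comm (λ g i → 𝟙 (lookup X i) *ℕ 𝟙 (lookup (∁ X) (translate (element g) i))) ⟩
      ∑[ i < order ] ∑[ g < order ] (𝟙 (lookup X i) *ℕ 𝟙 (lookup (∁ X) (translate (element g) i)))
        ≡⟨ sum-cong-≗ inner ⟩
      ∑[ i < order ] (𝟙 (lookup X i) *ℕ ∣ ∁ X ∣)
        ≡⟨ *-distribʳ-sum ∣ ∁ X ∣ (λ i → 𝟙 (lookup X i)) ⟨
      (∑[ i < order ] 𝟙 (lookup X i)) *ℕ ∣ ∁ X ∣
        ≡⟨ cong (_*ℕ ∣ ∁ X ∣) (∣p∣≡sum X) ⟨
      ∣ X ∣ *ℕ ∣ ∁ X ∣ ∎
      where
      open ≡-Reasoning
      inner : ∀ i → ∑[ g < order ] (𝟙 (lookup X i) *ℕ 𝟙 (lookup (∁ X) (translate (element g) i)))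
                    ≡ 𝟙 (lookup X i) *ℕ ∣ ∁ X ∣
      inner i = begin
        ∑[ g < order ] (𝟙 (lookup X i) *ℕ 𝟙 (lookup (∁ X) (translate (element g) i)))
          ≡⟨ *-distribˡ-sum (𝟙 (lookup X i)) (λ g → 𝟙 (lookup (∁ X) (translate (element g) i))) ⟨
        𝟙 (lookup X i) *ℕ ∑[ g < order ] 𝟙 (lookup (∁ X) (translate (element g) i))
          ≡⟨ cong (𝟙 (lookup X i) *ℕ_) (sum-cong-≗ (λ g →
               cong (𝟙 ∘ lookup (∁ X)) (index-cong (comm (element i) (element g))))) ⟩
        𝟙 (lookup X i) *ℕ ∑[ g < order ] 𝟙 (lookup (∁ X) (translate (element i) g))
          ≡⟨ cong (𝟙 (lookup X i) *ℕ_) (sum-translate (𝟙 ∘ lookup (∁ X)) (element i)) ⟨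
        𝟙 (lookup X i) *ℕ ∑[ g < order ] 𝟙 (lookup (∁ X) g)
          ≡⟨ cong (𝟙 (lookup X i) *ℕ_) (∣p∣≡sum (∁ X)) ⟨
        𝟙 (lookup X i) *ℕ ∣ ∁ X ∣ ∎

  -- Exponents in ℕ suffice, since in exponent `m` the inverse is the power `m - 1`.
  combination : (Fin order → ℕ) → Carrier
  combination a = ΣG.sum (λ s → a s · element s)

  combination-+ : ∀ a b → combination (λ s → a s + b s) ≈ combination a ∙ combination b
  combination-+ a b = ≈-trans (ΣG.sum-cong-≋ (λ s → ×-homo-+ (element s) (a s) (b s)))
                              (ΣG.∑-distrib-+ (λ s → a s · element s) (λ s → b s · element s))

  combination-0 : combination (λ _ → 0) ≈ ε
  combination-0 = ΣG.sum-replicate-zero order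

  combination-* : ∀ k a → combination (λ s → k *ℕ a s) ≈ k · combination a
  combination-* zero    a = combination-0
  combination-* (suc k) a =
    ≈-trans (combination-+ a (λ s → k *ℕ a s)) (∙-congˡ (combination-* k a))

  module _ {m} (exponent : IsExponent m) where
    private
      instance
        m-nonZero : NonZero m
        m-nonZero = >-nonZero (proj₁ (proj₁ exponent))

    m·x≈ε : ∀ x → m · x ≈ ε
    m·x≈ε = proj₂ (proj₁ exponent)

    inverse-power : ∀ k → suc k ≡ m → ∀ x → x ⁻¹ ≈ k · x
    inverse-power k refl x = ≈-sym (inverseʳ-unique x (k · x) (m·x≈ε x))

    %-power : ∀ k x → k · x ≈ (k ℕ.% m) · x
    %-power k x = begin
      k · x                            ≡⟨ cong (_· x) (trans (m≡m%n+[m/n]*n k m) (cong (λ z → k ℕ.% m + z) (*-comm (k ℕ./ m) m))) ⟩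
      (k ℕ.% m + m *ℕ (k ℕ./ m)) · x        ≈⟨ ×-homo-+ x (k ℕ.% m) (m *ℕ (k ℕ./ m)) ⟩
      (k ℕ.% m) · x ∙ (m *ℕ (k ℕ./ m)) · x  ≈⟨ ∙-congˡ (×-assocˡ x m (k ℕ./ m)) ⟨
      (k ℕ.% m) · x ∙ m · ((k ℕ./ m) · x)  ≈⟨ ∙-congˡ (m·x≈ε _) ⟩
      (k ℕ.% m) · x ∙ ε                  ≈⟨ identityʳ _ ⟩
      (k ℕ.% m) · x                      ∎
      where open SetoidReasoning ≈-setoid

    -- Reducing the exponent modulo `m` before using subadditivity makes the factor independent of
    -- `k`.
    displacement-·-≤ : ∀ X k x → displacement X (k · x) ≤ m *ℕ displacement X x
    displacement-·-≤ X k x = begin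
      displacement X (k · x)        ≡⟨ displacement-cong X (%-power k x) ⟩
      displacement X ((k ℕ.% m) · x)  ≤⟨ displacement-· X (k ℕ.% m) x ⟩
      (k ℕ.% m) *ℕ displacement X x   ≤⟨ *-monoˡ-≤ _ (<⇒≤ (m%n<n k m)) ⟩
      m *ℕ displacement X x         ∎
      where open ≤-Reasoning

    SupportedOn : Subset order → (Fin order → ℕ) → Set
    SupportedOn S a = ∀ s → lookup S s ≡ false → a s ≡ 0

    module _ {S : Subset order} where

      -- Induction on the generation of `x`. Commutativity gathers all occurrences of a generator
      -- into one power, and inversion multiplies every exponent by `m - 1`.
      generated⇒combination : ∀ {x} → ⟨ S ⟩ x → ∃[ a ] SupportedOn S a × x ≈ combination a
      generated⇒combination (gen {x} x∈S) = δ , supported , ≈-sym (begin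
        combination δ                        ≈⟨ sum-single commutativeMonoid _ (index x) others ⟩
        δ (index x) · element (index x)      ≡⟨ cong (_· element (index x)) δ-at ⟩
        1 · element (index x)                ≈⟨ identityʳ _ ⟩
        element (index x)                    ≈⟨ element-index x ⟩
        x                                    ∎)
        where
        open SetoidReasoning ≈-setoid
        δ : Fin order → ℕ
        δ s = 𝟙 (does (s ≟ index x))
        δ-at : δ (index x) ≡ 1
        δ-at with index x ≟ index x
        ... | yes _ = refl
        ... | no ≢  = contradiction refl ≢
        supported : SupportedOn S δ
        supported s Ss with s ≟ index x
        ... | no _     = refl
        ... | yes refl = contradiction (trans (sym ([]=⇒lookup x∈S)) Ss) λ ()
        others : ∀ s → s ≢ index x → δ s · element s ≈ ε
        others s s≢ with s ≟ index x
        ... | no _   = ≈-refl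
        ... | yes s≡ = contradiction s≡ s≢
      generated⇒combination one = (λ _ → 0) , (λ _ _ → refl) , ≈-sym combination-0
      generated⇒combination (mul p q) with generated⇒combination p | generated⇒combination q
      ... | a , a-on , x≈a | b , b-on , y≈b =
        (λ s → a s + b s) , (λ s Ss → cong₂ _+_ (a-on s Ss) (b-on s Ss)) ,
        ≈-trans (∙-cong x≈a y≈b) (≈-sym (combination-+ a b))
      generated⇒combination (inv {x} p) with generated⇒combination p
      ... | a , a-on , x≈a =
        (λ s → k *ℕ a s) , (λ s Ss → trans (cong (k *ℕ_) (a-on s Ss)) (*-zeroʳ k)) ,
        ≈-trans (inverse-power k (suc-pred m) x) (≈-trans (×-congʳ k x≈a) (≈-sym (combination-* k a)))
        where
        k = pred m
      generated⇒combination (resp x≈y p) with generated⇒combination p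
      ... | a , a-on , x≈a = a , a-on , ≈-trans (≈-sym x≈y) x≈a

      -- Each generator occurs in `x` as a single power, which costs at most `m` times its own
      -- displacement.
      displacement-≤ : Generates S → ∀ X x →
        displacement X x ≤ m *ℕ ∑[ s < order ] (𝟙 (lookup S s) *ℕ displacement X (element s))
      displacement-≤ generates X x with generated⇒combination (generates x)
      ... | a , a-on , x≈a = begin
        displacement X x                                   ≡⟨ displacement-cong X x≈a ⟩
        displacement X (combination a)                     ≤⟨ displacement-sum X (λ s → a s · element s) ⟩
        ∑[ s < order ] displacement X (a s · element s)    ≤⟨ sum-mono-≤ term ⟩
        ∑[ s < order ] (m *ℕ (𝟙 (lookup S s) *ℕ displacement X (element s)))
          ≡⟨ *-distribˡ-sum m (λ s → 𝟙 (lookup S s) *ℕ displacement X (element s)) ⟨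
        m *ℕ ∑[ s < order ] (𝟙 (lookup S s) *ℕ displacement X (element s)) ∎
        where
        open ≤-Reasoning
        term : ∀ s → displacement X (a s · element s) ≤ m *ℕ (𝟙 (lookup S s) *ℕ displacement X (element s))
        term s with lookup S s in Ss
        ... | true  rewrite *-identityˡ (displacement X (element s)) = displacement-·-≤ X (a s) (element s)
        ... | false rewrite a-on s Ss = ≤-trans (≤-reflexive (displacement-ε X)) z≤n

  -- Degrees and edge cuts of the Cayley graph.

  module _ (S : Subset order) (symmetric : Symmetric S) (ε∉S : ¬ (ε ∈ᴳ S)) where
    open Graph (cayleyGraph S symmetric ε∉S)

    -- Row `i` of the adjacency matrix is the indicator of `S` composed with the translation by
    -- `element i ⁻¹`, which is a permutation.
    cayley-degree : ∀ i → ∑[ j < order ] 𝟙 (adj i j) ≡ ∣ S ∣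
    cayley-degree i = sym (trans (∣p∣≡sum S) (sum-translate (𝟙 ∘ lookup S) (element i ⁻¹)))

    -- For fixed `i`, the substitution of the ratio of `j` and `i` for `s` is a bijection: `s` lies
    -- in `S` exactly when `i` and `j` are adjacent, and it carries `i` to `j`.
    cut≡displacement : ∀ X →
      ∑[ i < order ] ∑[ j < order ] (𝟙 (lookup X i) *ℕ (𝟙 (lookup (∁ X) j) *ℕ 𝟙 (adj i j)))
      ≡ ∑[ s < order ] (𝟙 (lookup S s) *ℕ displacement X (element s))
    cut≡displacement X = sym (begin
      ∑[ s < order ] (𝟙 (lookup S s) *ℕ displacement X (element s))
        ≡⟨ sum-cong-≗ (λ s → *-distribˡ-sum (𝟙 (lookup S s)) (λ i → 𝟙 (lookup X i) *ℕ 𝟙 (lookup (∁ X) (translate (element s) i)))) ⟩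
      ∑[ s < order ] ∑[ i < order ] (𝟙 (lookup S s) *ℕ (𝟙 (lookup X i) *ℕ 𝟙 (lookup (∁ X) (translate (element s) i))))
        ≡⟨ ∑-comm (λ s i → 𝟙 (lookup S s) *ℕ (𝟙 (lookup X i) *ℕ 𝟙 (lookup (∁ X) (translate (element s) i)))) ⟩
      ∑[ i < order ] ∑[ s < order ] (𝟙 (lookup S s) *ℕ (𝟙 (lookup X i) *ℕ 𝟙 (lookup (∁ X) (translate (element s) i))))
        ≡⟨ sum-cong-≗ (λ i → trans (sum-translate _ (element i ⁻¹)) (sum-cong-≗ (edge i))) ⟩
      ∑[ i < order ] ∑[ j < order ] (𝟙 (lookup X i) *ℕ (𝟙 (lookup (∁ X) j) *ℕ 𝟙 (adj i j))) ∎)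
      where
      open ≡-Reasoning
      edge : ∀ i j → let s = translate (element i ⁻¹) j in
        𝟙 (lookup S s) *ℕ (𝟙 (lookup X i) *ℕ 𝟙 (lookup (∁ X) (translate (element s) i)))
        ≡ 𝟙 (lookup X i) *ℕ (𝟙 (lookup (∁ X) j) *ℕ 𝟙 (adj i j))
      edge i j = trans (cong (λ k → 𝟙 (adj i j) *ℕ (𝟙 (lookup X i) *ℕ 𝟙 (lookup (∁ X) k))) (translate-ratio i j))
                       (trans (*-comm (𝟙 (adj i j)) _) (*-assoc (𝟙 (lookup X i)) _ _))

    -- The bound of `displacement-≤` does not depend on the group element, so summation over the
    -- group only adds the factor `order`, while the left-hand sides add up to `∣ X ∣ *ℕ ∣ ∁ X ∣`.
    isoperimetry : ∀ {m} → IsExponent m → Generates S → ∀ X → ∣ X ∣ *ℕ ∣ ∁ X ∣ ≤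
      order *ℕ (m *ℕ ∑[ i < order ] ∑[ j < order ] (𝟙 (lookup X i) *ℕ (𝟙 (lookup (∁ X) j) *ℕ 𝟙 (adj i j))))
    isoperimetry {m} exponent generates X = begin
      ∣ X ∣ *ℕ ∣ ∁ X ∣                                ≡⟨ sum-displacement X ⟨
      ∑[ g < order ] displacement X (element g)       ≤⟨ sum-mono-≤ (λ g → displacement-≤ exponent generates X (element g)) ⟩
      ∑[ g < order ] bound                            ≡⟨ sum-const order bound ⟩
      order *ℕ bound                                  ≡⟨ cong (λ e → order *ℕ (m *ℕ e)) (cut≡displacement X) ⟨
      _                                               ∎
      where
      open ≤-Reasoning
      bound = m *ℕ ∑[ s < order ] (𝟙 (lookup S s) *ℕ displacement X (element s))

-- Subsets given by predicates, and balanced edges of rank-decompositions.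

module _ {n} {P : Pred (Fin n) 0ℓ} (P? : Decidable P) where

  filterᶠ : Subset n
  filterᶠ = tabulate (λ i → does (P? i))

  ∈-filter⁺ : ∀ {i} → P i → i ∈ filterᶠ
  ∈-filter⁺ {i} Pi = lookup⇒[]= i _ (trans (lookup∘tabulate _ i) (dec-true (P? i) Pi))

  ∈-filter⁻ : ∀ {i} → i ∈ filterᶠ → P i
  ∈-filter⁻ {i} i∈ with P? i | trans (sym (lookup∘tabulate (λ j → does (P? j)) i)) ([]=⇒lookup i∈)
  ... | yes Pi | _  = Pi
  ... | no _   | ()

∈-tabulate⁺ : ∀ {n} (f : Fin n → Bool) {i} → f i ≡ true → i ∈ tabulate f
∈-tabulate⁺ f {i} fi = lookup⇒[]= i _ (trans (lookup∘tabulate f i) fi)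

∈-tabulate⁻ : ∀ {n} (f : Fin n → Bool) {i} → i ∈ tabulate f → f i ≡ true
∈-tabulate⁻ f {i} i∈ = trans (sym (lookup∘tabulate f i)) ([]=⇒lookup i∈)

x∉p-x : ∀ {n} (p : Subset n) x → x ∉ p - x
x∉p-x (_ ∷ p) zero    ()
x∉p-x (_ ∷ p) (suc x) (there x∈) = x∉p-x p x x∈

∣p∣+∣∁p∣≡n : ∀ {n} (p : Subset n) → ∣ p ∣ + ∣ ∁ p ∣ ≡ n
∣p∣+∣∁p∣≡n p = trans (cong (λ z → ∣ p ∣ + z) (∣∁p∣≡n∸∣p∣ p)) (m+[n∸m]≡n (∣p∣≤n p))

module Balanced {n} (D : RankDecomposition n) (2≤n : 2 ≤ n) where
  open RankDecomposition D

  leaf-injective : ∀ {i j} → leaf i ≡ leaf j → i ≡ j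
  leaf-injective eq = Bijection.injective leaves (Σ-≡ eq)
    where
    Σ-≡ : ∀ {x y : Leaf} → proj₁ x ≡ proj₁ y → x ≡ y
    Σ-≡ {x , p} {.x , q} refl = cong (x ,_) (≡-irrelevant p q)

  leavesAt : Fin nodes → ℕ
  leavesAt u = ∑[ i < n ] 𝟙 (does (leaf i ≟ u))

  leavesAt-none : ∀ u → (∀ i → leaf i ≢ u) → leavesAt u ≡ 0
  leavesAt-none u none =
    trans (sum-cong-≗ (λ i → cong 𝟙 (dec-false (leaf i ≟ u) (none i)))) (trans (sum-const n 0) (*-zeroʳ n))

  leavesAt≤1 : ∀ u → leavesAt u ≤ 1
  leavesAt≤1 u with any? (λ i → leaf i ≟ u)
  ... | no none = ≤-trans (≤-reflexive (leavesAt-none u (λ i eq → none (i , eq)))) z≤n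
  ... | yes (i , refl) = ≤-trans (≤-reflexive (sum-single +-0-commutativeMonoid _ i (λ j j≢i →
      cong 𝟙 (dec-false (leaf j ≟ leaf i) (j≢i ∘ leaf-injective))))) (𝟙≤1 _)

  record BalancedCut : Set where
    field
      {from to} : Fin nodes
      {side}    : Subset n
      edge      : Adj from to
      isSide    : IsSide from to side
      n≤3∣X∣    : n ≤ 3 *ℕ ∣ side ∣
      n≤3∣∁X∣   : n ≤ 3 *ℕ ∣ ∁ side ∣

  -- Decidable reachability turns the sides of edges into subsets; `balanced-cut-exists` supplies it
  -- under a double negation.
  module _ (reach? : ∀ u v x → Dec (Star (AdjWithout u v) v x)) where

    side : Fin nodes → Fin nodes → Subset n
    side u v = filterᶠ (λ i → reach? u v (leaf i))

    sideNodes : Fin nodes → Fin nodes → Subset nodes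
    sideNodes u v = filterᶠ (reach? u v)

    -- This is the measure for `descend`. The inclusion is strict because `u` belongs to its own
    -- side, whereas `bridge` excludes it from the branch at `c`.
    branch-nodes< : ∀ {p u c} → Adj u c → c ≢ p → ∣ sideNodes u c ∣ < ∣ sideNodes p u ∣
    branch-nodes< {p} {u} {c} uc c≢p = p⊂q⇒∣p∣<∣q∣
      ( ∈-filter⁺ (reach? p u) ∘ branch⊆side tree acyclic uc c≢p ∘ ∈-filter⁻ (reach? u c)
      , u , ∈-filter⁺ (reach? p u) Star.ε , bridge tree acyclic uc ∘ ∈-filter⁻ (reach? u c))

    cover-≤ : ∀ u (B : Subset nodes) (Y : Subset n) →
      (∀ i → i ∈ Y → leaf i ≡ u ⊎ ∃[ c ] c ∈ B × Star (AdjWithout u c) c (leaf i)) →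
      ∣ Y ∣ ≤ leavesAt u + ∑[ c < nodes ] (𝟙 (lookup B c) *ℕ ∣ side u c ∣)
    cover-≤ u B Y cover = begin
      ∣ Y ∣                                   ≡⟨ ∣p∣≡sum Y ⟩
      ∑[ i < n ] 𝟙 (lookup Y i)               ≤⟨ sum-mono-≤ pointwise ⟩
      ∑[ i < n ] (𝟙 (does (leaf i ≟ u)) + ∑[ c < nodes ] (𝟙 (lookup B c) *ℕ 𝟙 (lookup (side u c) i)))
        ≡⟨ ∑-distrib-+ (λ i → 𝟙 (does (leaf i ≟ u))) _ ⟩
      leavesAt u + ∑[ i < n ] ∑[ c < nodes ] (𝟙 (lookup B c) *ℕ 𝟙 (lookup (side u c) i))
        ≡⟨ cong (λ z → leavesAt u + z) (∑-comm (λ i c → 𝟙 (lookup B c) *ℕ 𝟙 (lookup (side u c) i))) ⟩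
      leavesAt u + ∑[ c < nodes ] ∑[ i < n ] (𝟙 (lookup B c) *ℕ 𝟙 (lookup (side u c) i))
        ≡⟨ cong (λ z → leavesAt u + z) (sum-cong-≗ (λ c → trans
             (sym (*-distribˡ-sum (𝟙 (lookup B c)) (λ i → 𝟙 (lookup (side u c) i))))
             (cong (𝟙 (lookup B c) *ℕ_) (sym (∣p∣≡sum (side u c)))))) ⟩
      leavesAt u + ∑[ c < nodes ] (𝟙 (lookup B c) *ℕ ∣ side u c ∣) ∎
      where
      open ≤-Reasoning
      pointwise : ∀ i → 𝟙 (lookup Y i) ≤
        𝟙 (does (leaf i ≟ u)) + ∑[ c < nodes ] (𝟙 (lookup B c) *ℕ 𝟙 (lookup (side u c) i))
      pointwise i with lookup Y i in Yi
      ... | false = z≤n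
      ... | true with cover i (lookup⇒[]= i Y Yi)
      ... | inj₁ at-u = ≤-trans (≤-reflexive (cong 𝟙 (sym (dec-true (leaf i ≟ u) at-u)))) (m≤m+n _ _)
      ... | inj₂ (c , c∈B , reach) = begin
        1                                                ≡⟨ cong₂ (λ x y → 𝟙 x *ℕ 𝟙 y) ([]=⇒lookup c∈B)
                                                              ([]=⇒lookup (∈-filter⁺ (λ j → reach? u c (leaf j)) reach)) ⟨
        𝟙 (lookup B c) *ℕ 𝟙 (lookup (side u c) i)        ≤⟨ term≤sum (λ c → 𝟙 (lookup B c) *ℕ 𝟙 (lookup (side u c) i)) c ⟩
        _                                                ≤⟨ m≤n+m _ (𝟙 (does (leaf i ≟ u))) ⟩
        _                                                ∎

    -- Three times the union bound `cover-≤`. It is used by contradiction: if every branch were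
    -- small, too few vertices would be covered.
    small-branches : ∀ u (B : Subset nodes) (Y : Subset n) →
      (∀ i → i ∈ Y → leaf i ≡ u ⊎ ∃[ c ] c ∈ B × Star (AdjWithout u c) c (leaf i)) →
      (∀ c → c ∈ B → 3 *ℕ ∣ side u c ∣ ≤ n) → 3 *ℕ ∣ Y ∣ ≤ 3 *ℕ leavesAt u + ∣ B ∣ *ℕ n
    small-branches u B Y cover small = begin
      3 *ℕ ∣ Y ∣
        ≤⟨ *-monoʳ-≤ 3 (cover-≤ u B Y cover) ⟩
      3 *ℕ (leavesAt u + ∑[ c < nodes ] (𝟙 (lookup B c) *ℕ ∣ side u c ∣))
        ≡⟨ *-distribˡ-+ 3 (leavesAt u) _ ⟩
      3 *ℕ leavesAt u + 3 *ℕ ∑[ c < nodes ] (𝟙 (lookup B c) *ℕ ∣ side u c ∣)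
        ≡⟨ cong (λ z → 3 *ℕ leavesAt u + z) (*-distribˡ-sum 3 (λ c → 𝟙 (lookup B c) *ℕ ∣ side u c ∣)) ⟩
      3 *ℕ leavesAt u + ∑[ c < nodes ] (3 *ℕ (𝟙 (lookup B c) *ℕ ∣ side u c ∣))
        ≡⟨ cong (λ z → 3 *ℕ leavesAt u + z) (sum-cong-≗ (λ c → swap (𝟙 (lookup B c)) ∣ side u c ∣)) ⟩
      3 *ℕ leavesAt u + ∑[ c < nodes ] (𝟙 (lookup B c) *ℕ (3 *ℕ ∣ side u c ∣))
        ≤⟨ +-monoʳ-≤ (3 *ℕ leavesAt u) (sum-over-subset-≤ B _ n small) ⟩
      3 *ℕ leavesAt u + ∣ B ∣ *ℕ n ∎
      where
      open ≤-Reasoning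
      swap : ∀ a b → 3 *ℕ (a *ℕ b) ≡ a *ℕ (3 *ℕ b)
      swap = solve-∀

    -- If `u` has degree 1, no branch lies ahead and at most one vertex sits at `u`, so 3 ≤ 4 ≤
    -- `2 *ℕ n` is enough. If it has degree 3, no vertex sits at `u` and two branches remain besides
    -- `p`.
    branches-≤2n : ∀ {p u} → Adj p u → 3 *ℕ leavesAt u + ∣ neighbours u - p ∣ *ℕ n ≤ 2 *ℕ n
    branches-≤2n {p} {u} pu with cubic u | x∈p⇒∣p-x∣<∣p∣ (∈-tabulate⁺ (adj u) (Adj-sym tree pu))
    ... | inj₁ deg≡1 | fewer rewrite deg≡1 | n≤0⇒n≡0 (≤-pred fewer) | +-identityʳ (3 *ℕ leavesAt u) =
      ≤-trans (*-monoʳ-≤ 3 (leavesAt≤1 u)) (≤-trans (n≤1+n 3) (*-monoʳ-≤ 2 2≤n))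
    ... | inj₂ deg≡3 | fewer = begin
      3 *ℕ leavesAt u + ∣ neighbours u - p ∣ *ℕ n ≡⟨ cong (λ k → 3 *ℕ k + ∣ neighbours u - p ∣ *ℕ n) (leavesAt-none u not-leaf) ⟩
      ∣ neighbours u - p ∣ *ℕ n                  ≤⟨ *-monoˡ-≤ n (≤-pred (≤-trans fewer (≤-reflexive deg≡3))) ⟩
      2 *ℕ n                                     ∎
      where
      open ≤-Reasoning
      not-leaf : ∀ i → leaf i ≢ u
      not-leaf i refl = contradiction (trans (sym (proj₂ (Bijection.to leaves i))) deg≡3) λ ()

    descend : ∀ {p u} → Acc _<_ ∣ sideNodes p u ∣ → Adj p u → n ≤ 3 *ℕ ∣ side p u ∣ → BalancedCut
    descend {p} {u} (acc rec) pu large with n ≤? 3 *ℕ ∣ ∁ (side p u) ∣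
    ... | yes large′ = record
      { edge = pu
      ; isSide = λ i → mk⇔ (∈-filter⁻ (λ j → reach? p u (leaf j))) (∈-filter⁺ (λ j → reach? p u (leaf j)))
      ; n≤3∣X∣ = large ; n≤3∣∁X∣ = large′ }
    ... | no small′ with any? (λ c → (c ∈? (neighbours u - p)) ×-dec (n ≤? 3 *ℕ ∣ side u c ∣))
    ... | yes (c , c∈ , large-c) = descend (rec (branch-nodes< uc c≢p)) uc large-c
      where
      uc : Adj u c
      uc = ∈-tabulate⁻ (adj u) (p─q⊆p (neighbours u) ⁅ p ⁆ c∈)
      c≢p : c ≢ p
      c≢p refl = x∉p-x (neighbours u) c c∈
    -- Here the complement is smaller than a third of `n`, and if all branches ahead held at most a
    -- third, so that the side ahead held at most two thirds, the total would fall short of `n`.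
    ... | no none = contradiction 3n<3n (<-irrefl refl)
      where
      cover : ∀ i → i ∈ side p u →
              leaf i ≡ u ⊎ ∃[ c ] c ∈ (neighbours u - p) × Star (AdjWithout u c) c (leaf i)
      cover i i∈ with last-exit tree proj₁ (∈-filter⁻ (λ j → reach? p u (leaf j)) i∈)
      ... | inj₁ at-u = inj₁ at-u
      ... | inj₂ (c , (uc , kept) , reach) = inj₂ (c ,
        x∈p∧x≢y⇒x∈p-y (∈-tabulate⁺ (adj u) uc) (λ c≡p → kept (inj₂ (refl , c≡p))) , reach)

      3n<3n : 3 *ℕ n < 3 *ℕ n
      3n<3n = begin-strict
        3 *ℕ n                                         ≡⟨ cong (3 *ℕ_) (∣p∣+∣∁p∣≡n (side p u)) ⟨
        3 *ℕ (∣ side p u ∣ + ∣ ∁ (side p u) ∣)         ≡⟨ *-distribˡ-+ 3 ∣ side p u ∣ _ ⟩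
        3 *ℕ ∣ side p u ∣ + 3 *ℕ ∣ ∁ (side p u) ∣      <⟨ +-monoʳ-< (3 *ℕ ∣ side p u ∣) (≰⇒> small′) ⟩
        3 *ℕ ∣ side p u ∣ + n
          ≤⟨ +-monoˡ-≤ n (≤-trans (small-branches u (neighbours u - p) (side p u) cover
               (λ c c∈ → ≰⇒≥ (λ large-c → none (c , c∈ , large-c)))) (branches-≤2n pu)) ⟩
        2 *ℕ n + n                                     ≡⟨ +-comm (2 *ℕ n) n ⟩
        3 *ℕ n                                         ∎
        where open ≤-Reasoning

    -- `2≤n` unfolds to `1 < n` and so yields a vertex; its leaf is where the descent starts.
    root : Fin nodes
    root = leaf (fromℕ< 2≤n)

    -- The only branch at `root` holds all vertices but the one at `root`. Were it small, `3 *ℕ n`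
    -- would be at most `3 + n`, which fails for `n` at least 2.
    balanced-cut : BalancedCut
    balanced-cut with any? (λ c → (c ∈? neighbours root) ×-dec (n ≤? 3 *ℕ ∣ side root c ∣))
    ... | yes (c , c∈ , large) = descend (<-wellFounded _) (∈-tabulate⁻ (adj _) c∈) large
    ... | no none = contradiction 3n<3n (<-irrefl refl)
      where
      cover : ∀ i → i ∈ ⊤ → leaf i ≡ root ⊎ ∃[ c ] c ∈ neighbours root × Star (AdjWithout root c) c (leaf i)
      cover i _ with last-exit tree (λ xy → xy) (connected root (leaf i))
      ... | inj₁ at-root = inj₁ at-root
      ... | inj₂ (c , rc , reach) = inj₂ (c , ∈-tabulate⁺ (adj root) rc , reach)

      3n<3n : 3 *ℕ n < 3 *ℕ n
      3n<3n = begin-strict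
        3 *ℕ n                                    ≡⟨ cong (3 *ℕ_) (∣⊤∣≡n n) ⟨
        3 *ℕ ∣ ⊤ {n} ∣                            ≤⟨ small-branches root (neighbours root) ⊤ cover
                                                       (λ c c∈ → ≰⇒≥ (λ large-c → none (c , c∈ , large-c))) ⟩
        3 *ℕ leavesAt root + degree root *ℕ n     ≡⟨ cong (λ d → 3 *ℕ leavesAt root + d *ℕ n)
                                                       (proj₂ (Bijection.to leaves (fromℕ< 2≤n))) ⟩
        3 *ℕ leavesAt root + 1 *ℕ n               ≤⟨ +-monoˡ-≤ (1 *ℕ n) (*-monoʳ-≤ 3 (leavesAt≤1 root)) ⟩
        -- `2 *ℕ 2 ≤ 2 *ℕ n` unfolds to `3 < 2 *ℕ n`.
        3 + 1 *ℕ n                                <⟨ +-monoˡ-< (1 *ℕ n) (*-monoʳ-≤ 2 2≤n) ⟩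
        2 *ℕ n + 1 *ℕ n                           ≡⟨ *-distribʳ-+ n 2 1 ⟨
        3 *ℕ n                                    ∎
        where open ≤-Reasoning

  -- Double negation commutes with quantification over a finite type, so excluded middle for each
  -- triple of nodes gives decidability for all of them at once.
  balanced-cut-exists : ¬ ¬ BalancedCut
  balanced-cut-exists none = decide (none ∘ balanced-cut)
    where
    pull : ∀ {k} {P : Fin k → Set} → (∀ i → ¬ ¬ P i) → ¬ ¬ (∀ i → P i)
    pull = sequence (RawMonad.rawApplicative ¬¬-Monad)
    decide : ¬ ¬ (∀ u v x → Dec (Star (AdjWithout u v) v x))
    decide = pull λ u → pull λ v → pull λ x → ¬¬-excluded-middle

-- Passage to rationals and assembly of the bound.

-- Unnormalised rationals keep their denominators as written, so the inequality there is plain cross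
-- multiplication.
⅑*[a/d]≤k : ∀ a d .{{_ : NonZero d}} k → a ≤ 9 *ℕ (d *ℕ k) → (+ 1 / 9) * (+ a / d) ≤ℚ + k / 1
⅑*[a/d]≤k a (suc d) k a≤9dk = ℚ.toℚᵘ-cancel-≤ (begin
  toℚᵘ ((+ 1 / 9) * (+ a / suc d))               ≃⟨ ℚ.toℚᵘ-homo-* (+ 1 / 9) (+ a / suc d) ⟩
  toℚᵘ (+ 1 / 9) ℚᵘ.* toℚᵘ (+ a / suc d)         ≃⟨ ℚᵘ.*-congˡ {toℚᵘ (+ 1 / 9)} (ℚ.toℚᵘ-fromℚᵘ (ℚᵘ.mkℚᵘ (+ a) d)) ⟩
  ℚᵘ.mkℚᵘ (+ 1) 8 ℚᵘ.* ℚᵘ.mkℚᵘ (+ a) d           ≤⟨ ℚᵘ.*≤* cross ⟩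
  ℚᵘ.mkℚᵘ (+ k) 0                                ≃⟨ ℚ.toℚᵘ-fromℚᵘ (ℚᵘ.mkℚᵘ (+ k) 0) ⟨
  toℚᵘ (+ k / 1)                                 ∎)
  where
  open ℚᵘ.≤-Reasoning
  cross : + 1 ℤ.* + a ℤ.* + 1 ℤ.≤ + k ℤ.* + (9 *ℕ suc d)
  cross = subst₂ ℤ._≤_ (sym (trans (ℤ.*-identityʳ _) (ℤ.*-identityˡ (+ a)))) (ℤ.pos-* k (9 *ℕ suc d))
    (ℤ.+≤+ (≤-trans a≤9dk (≤-reflexive (trans (sym (*-assoc 9 (suc d) k)) (*-comm (9 *ℕ suc d) k)))))

adj-comm : ∀ {n} (Γ : Graph n) x y → Graph.adj Γ x y ≡ Graph.adj Γ y x
adj-comm Γ x y with Graph.adj Γ x y in xy | Graph.adj Γ y x in yx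
... | true  | true  = refl
... | false | false = refl
... | true  | false = trans (sym (Graph.adj-sym Γ x y xy)) yx
... | false | true  = trans (sym xy) (Graph.adj-sym Γ y x yx)

-- `IsWidth` bounds only numbers known to be cut-ranks, so the chosen side must first be given one.
-- The empty set of rows starts the search for the maximum.
cut-rank-exists : ∀ {n} (Γ : Graph n) X → ¬ ¬ (∃[ r ] IsCutRank Γ X r)
cut-rank-exists {n} Γ X = max-exists _ n (λ { k (Y , _ , _ , refl) → ∣p∣≤n Y })
  (∅ , (λ {_} → ⊥⊆) , (λ a a⊆⊥ _ (i , i∈a) → ∉⊥ (a⊆⊥ i∈a)) , refl)

-- A group with at most one element has exponent 1.
order≥2 : (G : FiniteAbelianGroup) → let open FiniteAbelianGroup G in
          ∀ {m} → 2 ≤ m → IsExponent m → 2 ≤ order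
order≥2 G {m} 2≤m (_ , least) = ≰⇒> λ order≤1 → <⇒≱ 2≤m
  (least 1 (s≤s z≤n , λ x → ≈-trans (identityʳ x) (trivial order≤1 x)))
  where
  open FiniteAbelianGroup G
  open Isoperimetry G
  one-point : ∀ {n} → n ≤ 1 → (i j : Fin n) → i ≡ j
  one-point {suc zero}    _          zero zero = refl
  one-point {suc (suc n)} (s≤s ())
  trivial : order ≤ 1 → ∀ x → x ≈ ε
  trivial order≤1 x = ≈-trans (≈-sym (element-index x))
    (≈-trans (reflexive (cong element (one-point order≤1 (index x) (index ε)))) (element-index ε))

order≤9m∣S∣²rw : (G : FiniteAbelianGroup) → let open FiniteAbelianGroup G in
  (m : ℕ) (2≤m : 2 ≤ m) (exponent : IsExponent m)
  (S : Subset order) (symmetric : Symmetric S) (generates : Generates S) (ε∉S : ¬ (ε ∈ᴳ S)) →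
  ∀ rw → IsRankWidth (cayleyGraph S symmetric ε∉S) rw → order ≤ 9 *ℕ (m *ℕ ∣ S ∣ ^ 2 *ℕ rw)
order≤9m∣S∣²rw G m 2≤m exponent S symmetric generates ε∉S rw ((D , _ , max) , _) =
  -- Comparison of natural numbers is decidable, hence stable, so a balanced cut and its cut-rank
  -- may be used although they exist only up to double negation.
  decidable-stable (order ≤? _) λ fails →
  balanced-cut-exists λ cut →
  cut-rank-exists Γ (BalancedCut.side cut) λ (r , rank) →
  fails (bound cut rank)
  where
  open FiniteAbelianGroup G
  open Isoperimetry G
  Γ = cayleyGraph S symmetric ε∉S
  open Graph Γ using (adj)
  2≤n = order≥2 G 2≤m exponent
  open Balanced D 2≤n

  rows : ∀ i → ∑[ j < order ] 𝟙 (adj i j) ≤ ∣ S ∣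
  rows i = ≤-reflexive (cayley-degree S symmetric ε∉S i)

  cols : ∀ j → ∑[ i < order ] 𝟙 (adj i j) ≤ ∣ S ∣
  cols j = ≤-trans (≤-reflexive (sum-cong-≗ (λ i → cong 𝟙 (adj-comm Γ i j)))) (rows j)

  bound : (cut : BalancedCut) → ∀ {r} → IsCutRank Γ (BalancedCut.side cut) r →
          order ≤ 9 *ℕ (m *ℕ ∣ S ∣ ^ 2 *ℕ rw)
  -- The inequality is proved multiplied by `order`: the balanced cut gives `order` squared on the
  -- left, and `isoperimetry` brings one factor `order` on the right.
  bound cut {r} rank = *-cancelˡ-≤ order {{n-nonZero}} (begin
    order *ℕ order                               ≤⟨ *-mono-≤ n≤3∣X∣ n≤3∣∁X∣ ⟩
    3 *ℕ ∣ X ∣ *ℕ (3 *ℕ ∣ ∁ X ∣)                 ≡⟨ nine ∣ X ∣ ∣ ∁ X ∣ ⟩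
    9 *ℕ (∣ X ∣ *ℕ ∣ ∁ X ∣)                      ≤⟨ *-monoʳ-≤ 9 (isoperimetry S symmetric ε∉S exponent generates X) ⟩
    9 *ℕ (order *ℕ (m *ℕ cutSize))               ≤⟨ *-monoʳ-≤ 9 (*-monoʳ-≤ order (*-monoʳ-≤ m
                                                      (ones≤rank*Δ² adj ∣ S ∣ rows cols rank))) ⟩
    9 *ℕ (order *ℕ (m *ℕ (r *ℕ (∣ S ∣ *ℕ ∣ S ∣)))) ≤⟨ *-monoʳ-≤ 9 (*-monoʳ-≤ order (*-monoʳ-≤ m
                                                      (*-monoˡ-≤ (∣ S ∣ *ℕ ∣ S ∣) (max r (from , to , X , edge , isSide , rank))))) ⟩
    9 *ℕ (order *ℕ (m *ℕ (rw *ℕ (∣ S ∣ *ℕ ∣ S ∣)))) ≡⟨ rearrange order m rw ∣ S ∣ ⟩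
    order *ℕ (9 *ℕ (m *ℕ ∣ S ∣ ^ 2 *ℕ rw))       ∎)
    where
    open ≤-Reasoning
    open BalancedCut cut renaming (side to X)
    n-nonZero : NonZero order
    n-nonZero = >-nonZero (<⇒≤ 2≤n)
    cutSize = ∑[ i < order ] ∑[ j < order ] (𝟙 (lookup X i) *ℕ (𝟙 (lookup (∁ X) j) *ℕ 𝟙 (adj i j)))
    nine : ∀ x y → 3 *ℕ x *ℕ (3 *ℕ y) ≡ 9 *ℕ (x *ℕ y)
    nine = solve-∀
    rearrange : ∀ n m r s → 9 *ℕ (n *ℕ (m *ℕ (r *ℕ (s *ℕ s)))) ≡ n *ℕ (9 *ℕ (m *ℕ (s *ℕ (s *ℕ 1)) *ℕ r))
    rearrange = solve-∀

corollary11 : ∃[ c ] 0ℚ <ℚ c ×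
    ((G : FiniteAbelianGroup) → let open FiniteAbelianGroup G in
    (m : ℕ) (2≤m : 2 ≤ m) (exponent : IsExponent m)
    (S : Subset order) (symmetric : Symmetric S) (generates : Generates S)
    (ε∉S : ¬ (ε ∈ᴳ S)) →
    ∀ rw → IsRankWidth (cayleyGraph S symmetric ε∉S) rw →
    c * (_/_ (+ order) (m *ℕ ∣ S ∣ ^ 2) {{denominator-nonZero 2≤m exponent S generates}})
    ≤ℚ (+ rw) / 1)
-- The constant is the product of the two thirds guaranteed by a balanced cut.
corollary11 = + 1 / 9 , ℚ.positive⁻¹ (+ 1 / 9) ,
  λ G m 2≤m exponent S symmetric generates ε∉S rw isRankWidth →
    ⅑*[a/d]≤k (FiniteAbelianGroup.order G) (m *ℕ ∣ S ∣ ^ 2)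
      {{FiniteAbelianGroup.denominator-nonZero G 2≤m exponent S generates}} rw
      (order≤9m∣S∣²rw G m 2≤m exponent S symmetric generates ε∉S rw isRankWidth)
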